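{- Let $n=2p$, where $p$ is an odd prime. A sequence $S$ in $\mathbb{Z}_n$ is a $U(n)$-extremal sequence for the Gao constant if and only if $S$ is $U(n)$-equivalent to a sequence of length $n+1$ having one of the following forms: $(\star)$ $\ (b_1,\ p_1b_2,\ \underbrace{0,\ldots,0}_{n-1\text{ times}})$, where $\{p_1,p_2\}=\{2,p\}$ and $b_1,b_2$ are integers with $b_i$ coprime to $p_i$ for $i=1,2$; $(\ast)$ $\ (b,\ \underbrace{p,\ldots,p}_{m\text{ times}},\ \underbrace{0,\ldots,0}_{n-m\text{ times}})$, where $b$ is an integer coprime to $p$ and $m$ is an odd integer with $1\le m\le n$; $(\ast\ast)$ $\ (c,\ 1,\ \underbrace{p,\ldots,p}_{n-1\text{ times}})$, where $c$ is an even integer.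
   Context: $\mathbb{Z}_n=\mathbb{Z}/n\mathbb{Z}$ and $U(n)$ is its group of units; integers are identified with their images in $\mathbb{Z}_n$. A sequence is a finite list $(x_1,\ldots,x_l)$ of elements of $\mathbb{Z}_n$ (repetitions allowed); a subsequence is obtained by restricting to a subset of the indices. For $A\subseteq\mathbb{Z}_n$, a subsequence of $(x_1,\ldots,x_l)$ with index set $I$ is an $A$-weighted zero-sum subsequence if $I\ne\emptyset$ and there exist $a_i\in A$ ($i\in I$) with $\sum_{i\in I}a_ix_i=0$. The $A$-weighted Gao constant $E_A(n)$ is the least positive integer $k$ such that every sequence of length $k$ in $\mathbb{Z}_n$ has an $A$-weighted zero-sum subsequence of length $n$. An $A$-extremal sequence for the Gao constant is a sequence in $\mathbb{Z}_n$ of length $E_A(n)-1$ which has no $A$-weighted zero-sum subsequence of length $n$. For a subgroup $A$ of $U(n)$, two sequences $(x_1,\ldots,x_l)$ and $(y_1,\ldots,y_l)$ in $\mathbb{Z}_n$ are $A$-equivalent if there exist $c\in U(n)$, a permutation $\sigma$ of $\{1,\ldots,l\}$ and $a_1,\ldots,a_l\in A$ such that $c\,y_{\sigma(i)}=a_ix_i$ for all $1\le i\le l$. -}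

module Defs where

open import Data.Bool.Base using (if_then_else_)
open import Data.Fin.Base using (Fin)
open import Data.Fin.Permutation using (Permutation; _⟨$⟩ʳ_)
open import Data.Fin.Subset using (Subset; Nonempty; _∈_; ∣_∣)
open import Data.Integer.Base using (ℤ; +_; 0ℤ; 1ℤ; _*_; _-_)
open import Data.Integer.Coprimality using (Coprime)
open import Data.Integer.Divisibility.Signed using (_∣_)
open import Data.Integer.Properties using (+-0-commutativeMonoid)
open import Data.List.Base using (List; _∷_; _++_; length; lookup; replicate)
open import Data.Nat.Base as ℕ using (ℕ; suc; _∸_)
import Data.Nat.Divisibility as ℕ
open import Data.Product.Base using (_×_; ∃; ∃-syntax)
open import Data.Sum.Base using (_⊎_)
import Data.Vec.Base as Vec
open import Level using (0ℓ)
open import Relation.Binary.PropositionalEquality.Core using (_≡_)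
open import Relation.Nullary.Negation.Core using (¬_)
open import Relation.Unary using (Pred)

open import Algebra.Properties.CommutativeMonoid.Sum +-0-commutativeMonoid
  using (sum)

-- The ring ℤ/nℤ is the setoid of integers under congruence modulo n.
-- A set A of integers stands for the set of residue classes it represents.

infix 4 _≡_[mod_]

_≡_[mod_] : ℤ → ℤ → ℕ → Set
x ≡ y [mod n ] = + n ∣ x - y

U : ℕ → Pred ℤ 0ℓ
U n x = ∃[ y ] x * y ≡ 1ℤ [mod n ]

Sequence : Set
Sequence = List ℤ

sumOver : ∀ {l} → Subset l → (Fin l → ℤ) → ℤ
sumOver I f = sum λ i → if Vec.lookup I i then f i else 0ℤ

-- The weights outside I are irrelevant, so a may be taken total.
IsWeightedZeroSum : (n : ℕ) → Pred ℤ 0ℓ → (S : Sequence) →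
                    Subset (length S) → Set
IsWeightedZeroSum n A S I =
  Nonempty I ×
  ∃ λ (a : Fin (length S) → ℤ) →
    (∀ i → i ∈ I → A (a i)) ×
    sumOver I (λ i → a i * lookup S i) ≡ 0ℤ [mod n ]

HasWeightedZeroSumOfLength : (n : ℕ) → Pred ℤ 0ℓ → ℕ → Sequence → Set
HasWeightedZeroSumOfLength n A k S =
  ∃[ I ] ∣ I ∣ ≡ k × IsWeightedZeroSum n A S I

GaoProperty : (n : ℕ) → Pred ℤ 0ℓ → ℕ → Set
GaoProperty n A k =
  ∀ (S : Sequence) → length S ≡ k → HasWeightedZeroSumOfLength n A n S

IsGaoConstant : (n : ℕ) → Pred ℤ 0ℓ → ℕ → Set
IsGaoConstant n A k =
  1 ℕ.≤ k × GaoProperty n A k ×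
  (∀ j → 1 ℕ.≤ j → GaoProperty n A j → k ℕ.≤ j)

IsGaoExtremal : (n : ℕ) → Pred ℤ 0ℓ → Sequence → Set
IsGaoExtremal n A S =
  ∃[ k ] IsGaoConstant n A k × length S ≡ k ∸ 1 ×
         ¬ HasWeightedZeroSumOfLength n A n S

-- A bijection Fin (length S) ↔ Fin (length T) exists only if the two
-- lengths agree, so equality of lengths is not a separate condition.
Equivalent : (n : ℕ) → Pred ℤ 0ℓ → Sequence → Sequence → Set
Equivalent n A S T =
  ∃[ c ] U n c ×
  ∃ λ (σ : Permutation (length S) (length T)) →
  ∃ λ (a : Fin (length S) → ℤ) →
    (∀ i → A (a i)) ×
    (∀ i → c * lookup T (σ ⟨$⟩ʳ i) ≡ a i * lookup S i [mod n ])

Odd : ℕ → Set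
Odd m = ¬ (2 ℕ.∣ m)

Form⋆ : (n p : ℕ) → Sequence → Set
Form⋆ n p T =
  ∃[ p₁ ] ∃[ p₂ ] ((p₁ ≡ 2 × p₂ ≡ p) ⊎ (p₁ ≡ p × p₂ ≡ 2)) ×
  ∃[ b₁ ] ∃[ b₂ ] Coprime b₁ (+ p₁) × Coprime b₂ (+ p₂) ×
  T ≡ b₁ ∷ + p₁ * b₂ ∷ replicate (n ∸ 1) 0ℤ

Form∗ : (n p : ℕ) → Sequence → Set
Form∗ n p T =
  ∃[ b ] ∃[ m ] Coprime b (+ p) × Odd m × 1 ℕ.≤ m × m ℕ.≤ n ×
  T ≡ b ∷ replicate m (+ p) ++ replicate (n ∸ m) 0ℤ

Form∗∗ : (n p : ℕ) → Sequence → Set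
Form∗∗ n p T =
  ∃[ c ] + 2 ∣ c × T ≡ c ∷ 1ℤ ∷ replicate (n ∸ 1) (+ p)

{-# OPTIONS --safe #-}

-- Write χ(x) = 0 if p divides x and χ(x) = 1 otherwise. Multiplying by units
-- keeps the parity of x and χ(x), and nothing else. Hence a sequence has a zero
-- sum with unit weights iff its sum is even and the number of its terms prime to
-- p, its support, is not 1: two or more units modulo the odd prime p can be
-- scaled so that they cancel.
--
-- In a sequence of length n + 1 with support neither 1 nor 2, some term has the
-- parity of the whole sum, because the length is odd; deleting it leaves a zero
-- sum. So an extremal sequence has support 1 or 2. If it is 1, deleting the term
-- prime to p must leave an odd number of p's, which is (∗). If it is 2, no
-- multiple of p may have the parity of the sum, so the multiples of p are all 0
-- or all p, and the two other terms have opposite parities: this is (⋆) or (∗∗).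
module Submission where

open import Defs
open import Algebra.Properties.CommutativeMonoid.Sum as Sum using ()
open import Data.Bool.Base using (if_then_else_)
open import Data.Empty using (⊥)
open import Data.Fin.Base using (Fin; zero; suc)
open import Data.Fin.Permutation using (Permutation; _⟨$⟩ʳ_; ↔⇒≡)
open import Data.Fin.Subset using (Subset; Nonempty; inside; outside)
  renaming (_∈_ to _∈ˢ_; ∣_∣ to size)
open import Data.Integer.Base as ℤ using (ℤ; +_; -[1+_]; 0ℤ; 1ℤ; -1ℤ; -_; _-_; _⊖_)
  renaming (_+_ to _+ᶻ_; _*_ to _*ᶻ_; ∣_∣ to ∣_∣ᶻ)
open import Data.Integer.Coprimality using (Coprime)
open import Data.Integer.Divisibility.Signed
import Data.Integer.Properties as ℤ
open import Data.Integer.Tactic.RingSolver using (solve-∀)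
open import Data.List.Base using ([]; _∷_; _++_; length; lookup; replicate; take; drop)
open import Data.List.Membership.Propositional.Properties using (∈-lookup)
import Data.List.Properties as List
open import Data.List.Relation.Binary.Permutation.Homogeneous using (onIndices)
open import Data.List.Relation.Binary.Permutation.Propositional
  using (_↭_; ↭⇒↭ₛ′; refl; prep; swap; trans; ↭-sym; ↭-trans; module PermutationReasoning)
open import Data.List.Relation.Binary.Permutation.Propositional.Properties
  using (shift; shifts; ↭-length; ∈-resp-↭; ++-comm; ++⁺ˡ)
import Data.List.Relation.Binary.Permutation.Setoid as Permutationₛ
import Data.List.Relation.Binary.Permutation.Setoid.Properties as Permutationₛ′
open import Data.List.Relation.Binary.Sublist.Propositional using (_⊆_; []; _∷_; _∷ʳ_; ⊆-refl)
import Data.List.Relation.Binary.Sublist.Propositional.Properties as Sublist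
open import Data.List.Relation.Unary.All as All using (All; []; _∷_)
import Data.List.Relation.Unary.All.Properties as All
open import Data.List.Relation.Unary.Any as Any using (Any; here; there; any?)
open import Data.List.Relation.Unary.Any.Properties using (lookup-index)
open import Data.Nat.Base as ℕ using (ℕ; zero; suc; _+_; _*_; _∸_; parity; NonZero)
import Data.Nat.Coprimality as ℕ
import Data.Nat.Divisibility as ℕ
open import Data.Nat.GCD using (module Bézout)
open import Data.Nat.Primality using (Prime; euclidsLemma; prime⇒irreducible; prime⇒nonZero; prime⇒nonTrivial)
import Data.Nat.Properties as ℕ
open import Data.Parity.Base as ℙ using (Parity; 0ℙ; 1ℙ)
open import Data.Parity.Properties as ℙ using (suc-homo-⁻¹; +-homo-+; *-homo-*)
open import Data.Product.Base using (_×_; _,_; ∃; ∃-syntax; proj₁; proj₂)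
open import Data.Sum.Base using (_⊎_; inj₁; inj₂; [_,_])
import Data.Vec.Base as Vec
open import Function.Base using (_∘_; case_of_)
open import Function.Bundles using (_⇔_; mk⇔)
open import Level using (0ℓ)
open import Relation.Binary.Bundles using (Setoid)
open import Relation.Binary.PropositionalEquality using (_≡_; _≢_; refl; sym; cong; cong₂; subst; module ≡-Reasoning)
  renaming (trans to ≡-trans)
open import Relation.Nullary using (¬_; yes; no; does)
open import Relation.Nullary.Decidable using (dec-true; dec-false)
open import Relation.Nullary.Negation using (contradiction)
open import Relation.Unary using (Pred)

open Sum ℙ.+-0-commutativeMonoid using ()
  renaming (sum to sumᴾ; sum-permute to sumᴾ-permute; sum-cong-≗ to sumᴾ-cong)
open Sum ℕ.+-0-commutativeMonoid using ()
  renaming (sum to sumᴺ; sum-permute to sumᴺ-permute; sum-cong-≗ to sumᴺ-cong)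

-- Parities of integers and of sums

≢⇒≡⁻¹ : ∀ {a b} → a ≢ b → a ≡ b ℙ.⁻¹
≢⇒≡⁻¹ {0ℙ} {0ℙ} a≢b = contradiction refl a≢b
≢⇒≡⁻¹ {0ℙ} {1ℙ} a≢b = refl
≢⇒≡⁻¹ {1ℙ} {0ℙ} a≢b = refl
≢⇒≡⁻¹ {1ℙ} {1ℙ} a≢b = contradiction refl a≢b

parityℤ : ℤ → Parity
parityℤ x = parity ∣ x ∣ᶻ

-- Addition and subtraction agree modulo 2. This is the mixed-sign case of `parityℤ-+`, where the
-- sum of integers reduces to `⊖`.
parity-⊖ : ∀ m n → parityℤ (m ⊖ n) ≡ parity m ℙ.+ parity n
parity-⊖ zero    zero    = refl
parity-⊖ zero    (suc n) = refl
parity-⊖ (suc m) zero    = sym (ℙ.+-identityʳ _)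
parity-⊖ (suc m) (suc n) = begin
  parityℤ (suc m ⊖ suc n)            ≡⟨ cong parityℤ (ℤ.[1+m]⊖[1+n]≡m⊖n m n) ⟩
  parityℤ (m ⊖ n)                    ≡⟨ parity-⊖ m n ⟩
  parity m ℙ.+ parity n              ≡⟨ cong₂ ℙ._+_ (suc-homo-⁻¹ m) (suc-homo-⁻¹ n) ⟨
  parity (suc m) ℙ.⁻¹ ℙ.+ parity (suc n) ℙ.⁻¹
                                     ≡⟨ ⁻¹-cancel (parity (suc m)) _ ⟩
  parity (suc m) ℙ.+ parity (suc n)  ∎
  where
  open ≡-Reasoning
  ⁻¹-cancel : ∀ a b → a ℙ.⁻¹ ℙ.+ b ℙ.⁻¹ ≡ a ℙ.+ b
  ⁻¹-cancel 0ℙ b = ℙ.⁻¹-involutive b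
  ⁻¹-cancel 1ℙ b = refl

parityℤ-+ : ∀ x y → parityℤ (x +ᶻ y) ≡ parityℤ x ℙ.+ parityℤ y
parityℤ-+ (+ m)    (+ n)    = +-homo-+ m n
parityℤ-+ (+ m)    -[1+ n ] = parity-⊖ m (suc n)
parityℤ-+ -[1+ m ] (+ n)    = ≡-trans (parity-⊖ n (suc m)) (ℙ.+-comm (parity n) _)
parityℤ-+ -[1+ m ] -[1+ n ] =
  ≡-trans (cong parity (cong suc (sym (ℕ.+-suc m n)))) (+-homo-+ (suc m) (suc n))

parityℤ-* : ∀ x y → parityℤ (x *ᶻ y) ≡ parityℤ x ℙ.* parityℤ y
parityℤ-* x y = ≡-trans (cong parity (ℤ.abs-* x y)) (*-homo-* ∣ x ∣ᶻ ∣ y ∣ᶻ)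

parityℤ-neg : ∀ x → parityℤ (- x) ≡ parityℤ x
parityℤ-neg x = cong parity (ℤ.∣-i∣≡∣i∣ x)

2∣⇒even : ∀ {m} → 2 ℕ.∣ m → parity m ≡ 0ℙ
2∣⇒even (ℕ.divides-refl q) = ≡-trans (*-homo-* q 2) (ℙ.*-zeroʳ _)

even⇒2∣ : ∀ m → parity m ≡ 0ℙ → 2 ℕ.∣ m
even⇒2∣ zero          _ = ℕ.divides-refl 0
even⇒2∣ (suc (suc m)) e with even⇒2∣ m e
... | ℕ.divides-refl q = ℕ.divides-refl (suc q)

odd⇒Odd : ∀ {m} → parity m ≡ 1ℙ → Odd m
odd⇒Odd o e with () ← ≡-trans (sym o) (2∣⇒even e)

Odd⇒odd : ∀ m → Odd m → parity m ≡ 1ℙ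
Odd⇒odd m o with parity m in eq
... | 0ℙ = contradiction (even⇒2∣ m eq) o
... | 1ℙ = refl

2∣⇒evenℤ : ∀ {x} → + 2 ∣ x → parityℤ x ≡ 0ℙ
2∣⇒evenℤ = 2∣⇒even ∘ ∣⇒∣ᵤ

parityΣ : Sequence → Parity
parityΣ S = sumᴾ (parityℤ ∘ lookup S)

-- Permutations, sublists and the selection of terms

⊆-resp-↭ : ∀ {T S S′ : Sequence} → T ⊆ S → S ↭ S′ → ∃[ T′ ] T′ ⊆ S′ × T ↭ T′
⊆-resp-↭ τ refl = _ , τ , refl
⊆-resp-↭ (_ ∷ʳ τ) (prep x π) with ⊆-resp-↭ τ π
... | _ , τ′ , ρ = _ , x ∷ʳ τ′ , ρ
⊆-resp-↭ (refl ∷ τ) (prep x π) with ⊆-resp-↭ τ π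
... | _ , τ′ , ρ = _ , refl ∷ τ′ , prep x ρ
⊆-resp-↭ (_ ∷ʳ _ ∷ʳ τ) (swap x y π) with ⊆-resp-↭ τ π
... | _ , τ′ , ρ = _ , y ∷ʳ x ∷ʳ τ′ , ρ
⊆-resp-↭ (_ ∷ʳ refl ∷ τ) (swap x y π) with ⊆-resp-↭ τ π
... | _ , τ′ , ρ = _ , refl ∷ x ∷ʳ τ′ , prep y ρ
⊆-resp-↭ (refl ∷ _ ∷ʳ τ) (swap x y π) with ⊆-resp-↭ τ π
... | _ , τ′ , ρ = _ , y ∷ʳ refl ∷ τ′ , prep x ρ
⊆-resp-↭ (refl ∷ refl ∷ τ) (swap x y π) with ⊆-resp-↭ τ π
... | _ , τ′ , ρ = _ , refl ∷ refl ∷ τ′ , swap x y ρ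
⊆-resp-↭ τ (trans π₁ π₂) with ⊆-resp-↭ τ π₁
... | _ , τ₁ , ρ₁ with ⊆-resp-↭ τ₁ π₂
... | _ , τ₂ , ρ₂ = _ , τ₂ , ↭-trans ρ₁ ρ₂

size>0⇒nonempty : ∀ {l} (I : Subset l) → 0 ℕ.< size I → Nonempty I
size>0⇒nonempty (inside  Vec.∷ I) _ = zero , Vec.here
size>0⇒nonempty (outside Vec.∷ I) lt with size>0⇒nonempty I lt
... | i , i∈I = suc i , Vec.there i∈I

extract : ∀ {P : Pred ℤ 0ℓ} {S : Sequence} → Any P S → ∃[ z ] ∃[ T ] P z × S ↭ z ∷ T
extract (here pz) = _ , _ , pz , refl
extract (there {x} any) with extract any
... | z , T , pz , π = z , x ∷ T , pz , trans (prep x π) (swap x z refl)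

-- With only two parities, a failed search for `q` fixes the parity of every term. Deletions chosen
-- by parity rest on this dichotomy.
select-parity : ∀ q S → (∃[ z ] ∃[ T ] parityℤ z ≡ q × S ↭ z ∷ T) ⊎ All (λ z → parityℤ z ≡ q ℙ.⁻¹) S
select-parity q S with any? (λ z → parityℤ z ℙ.≟ q) S
... | yes any = inj₁ (extract any)
... | no ¬any = inj₂ (All.map ≢⇒≡⁻¹ (All.¬Any⇒All¬ S ¬any))

parity-suc : ∀ m → parity (suc m) ≡ parity m ℙ.⁻¹
parity-suc m = ≡-trans (sym (ℙ.⁻¹-involutive _)) (cong ℙ._⁻¹ (suc-homo-⁻¹ m))

parityΣ-constant : ∀ {q S} → All (λ z → parityℤ z ≡ q) S → parityΣ S ≡ parity (length S) ℙ.* q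
parityΣ-constant []                = refl
parityΣ-constant {q} {z ∷ S} (e ∷ es)
  rewrite e | parityΣ-constant es | parity-suc (length S) = ⁻¹-* (parity (length S)) q
  where
  ⁻¹-* : ∀ a q → q ℙ.+ (a ℙ.* q) ≡ a ℙ.⁻¹ ℙ.* q
  ⁻¹-* 0ℙ q = ℙ.+-identityʳ q
  ⁻¹-* 1ℙ q = ℙ.p+p≡0ℙ q

odd⇒parityΣ-constant : ∀ {q S} → parity (length S) ≡ 1ℙ → All (λ z → parityℤ z ≡ q) S → parityΣ S ≡ q
odd⇒parityΣ-constant {q} {S} o es = ≡-trans (parityΣ-constant es) (cong (ℙ._* q) o)

coprime-2⇒odd : ∀ {x} → Coprime x (+ 2) → parityℤ x ≡ 1ℙ
coprime-2⇒odd {x} c = Odd⇒odd ∣ x ∣ᶻ λ 2∣x → case c (2∣x , ℕ.∣-refl) of λ ()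

-- Arithmetic modulo 2, `p` and `n = 2p`

module _ {n p : ℕ} (p-prime : Prime p) (p-odd : Odd p) (n≡2p : n ≡ 2 * p) where

  private instance
    p≢0 : NonZero p
    p≢0 = prime⇒nonZero p-prime

  0<n : 0 ℕ.< n
  0<n = subst (0 ℕ.<_) (sym n≡2p) (ℕ.<-≤-trans (ℕ.>-nonZero⁻¹ p) (ℕ.m≤m+n p _))

  parity-p : parity p ≡ 1ℙ
  parity-p = Odd⇒odd p p-odd

  p∣n : + p ∣ + n
  p∣n = divides (+ 2) (≡-trans (cong +_ n≡2p) (ℤ.pos-* 2 p))

  2∣n : + 2 ∣ + n
  2∣n = ∣ᵤ⇒∣ (ℕ.divides p (≡-trans n≡2p (ℕ.*-comm 2 p)))

  parity-n : parity n ≡ 0ℙ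
  parity-n = 2∣⇒evenℤ 2∣n

  p∤1 : ¬ + p ∣ 1ℤ
  p∤1 d with ℕ.∣1⇒≡1 (∣⇒∣ᵤ d)
  ... | refl = contradiction p-prime λ ()

  opaque
    euclid : ∀ x y → + p ∣ x *ᶻ y → (+ p ∣ x) ⊎ (+ p ∣ y)
    euclid x y d with euclidsLemma ∣ x ∣ᶻ ∣ y ∣ᶻ p-prime (subst (p ℕ.∣_) (ℤ.abs-* x y) (∣⇒∣ᵤ d))
    ... | inj₁ d′ = inj₁ (∣ᵤ⇒∣ d′)
    ... | inj₂ d′ = inj₂ (∣ᵤ⇒∣ d′)

  p∤2 : ¬ + p ∣ + 2
  p∤2 d with ℕ.∣⇒≤ (∣⇒∣ᵤ d)
  ... | ℕ.s≤s (ℕ.s≤s ℕ.z≤n) = p-odd ℕ.∣-refl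
  ... | ℕ.s≤s ℕ.z≤n = p∤1 ∣-refl

  opaque
    -- Write `x` as `q *ᶻ + 2`; by Euclid's lemma `p` divides `q`, since it does not divide 2.
    -- Congruences modulo `n` are established through this lemma, by checking them modulo 2 and
    -- modulo `p`.
    even∧p∣⇒n∣ : ∀ x → parityℤ x ≡ 0ℙ → + p ∣ x → + n ∣ x
    even∧p∣⇒n∣ x e d with ∣ᵤ⇒∣ {+ 2} {x} (even⇒2∣ ∣ x ∣ᶻ e)
    ... | divides q refl with euclid q (+ 2) d
    ... | inj₂ p∣2 = contradiction p∣2 p∤2
    ... | inj₁ (divides r refl) = divides r (begin
      r *ᶻ + p *ᶻ + 2      ≡⟨ ℤ.*-assoc r (+ p) (+ 2) ⟩
      r *ᶻ (+ p *ᶻ + 2)    ≡⟨ cong (r *ᶻ_) (ℤ.pos-* p 2) ⟨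
      r *ᶻ + (p * 2)       ≡⟨ cong (λ m → r *ᶻ + m) (≡-trans (ℕ.*-comm p 2) (sym n≡2p)) ⟩
      r *ᶻ + n             ∎)
      where open ≡-Reasoning

  coprime⇒∤ : ∀ {x} → Coprime x (+ p) → ¬ + p ∣ x
  coprime⇒∤ c d with c (∣⇒∣ᵤ d , ℕ.∣-refl)
  ... | refl = p∤1 ∣-refl

  ∤⇒coprime : ∀ {x} → ¬ + p ∣ x → Coprime x (+ p)
  ∤⇒coprime p∤x {d} (d∣x , d∣p) with prime⇒irreducible p-prime d∣p
  ... | inj₁ d≡1 = d≡1
  ... | inj₂ refl = contradiction (∣ᵤ⇒∣ d∣x) p∤x

  opaque
    -- Bézout's identity for `∣ x ∣ᶻ` and `p` has two sign patterns, and the second yields the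
    -- negated coefficient. The sign of `x` is then passed on to the inverse.
    inverse : ∀ x → ¬ + p ∣ x → ∃[ y ] + p ∣ x *ᶻ y - 1ℤ
    inverse x p∤x with ℕ.coprime-Bézout (∤⇒coprime p∤x)
    ... | b = signed x (natural b)
      where
      open ≡-Reasoning
      natural : Bézout.Identity 1 ∣ x ∣ᶻ p → ∃[ y ] + p ∣ + ∣ x ∣ᶻ *ᶻ y - 1ℤ
      natural (Bézout.+- u v eq) = + u , divides (+ v) (begin
        + ∣ x ∣ᶻ *ᶻ + u - 1ℤ         ≡⟨ cong (_- 1ℤ) (ℤ.*-comm (+ ∣ x ∣ᶻ) (+ u)) ⟩
        + u *ᶻ + ∣ x ∣ᶻ - 1ℤ         ≡⟨ cong (_- 1ℤ) (ℤ.pos-* u _) ⟨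
        + (u * ∣ x ∣ᶻ) - 1ℤ          ≡⟨ cong (λ m → + m - 1ℤ) eq ⟨
        1ℤ +ᶻ + (v * p) - 1ℤ         ≡⟨ cancel (+ (v * p)) ⟩
        + (v * p)                    ≡⟨ ℤ.pos-* v p ⟩
        + v *ᶻ + p                   ∎)
        where
        cancel : ∀ z → 1ℤ +ᶻ z - 1ℤ ≡ z
        cancel = solve-∀
      natural (Bézout.-+ u v eq) = - + u , divides (- + v) (begin
        + ∣ x ∣ᶻ *ᶻ (- + u) - 1ℤ     ≡⟨ rearrange (+ ∣ x ∣ᶻ) (+ u) ⟩
        - (1ℤ +ᶻ + u *ᶻ + ∣ x ∣ᶻ)    ≡⟨ cong (λ z → - (1ℤ +ᶻ z)) (ℤ.pos-* u _) ⟨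
        - + (1 + u * ∣ x ∣ᶻ)         ≡⟨ cong (λ m → - + m) eq ⟩
        - + (v * p)                  ≡⟨ cong -_ (ℤ.pos-* v p) ⟩
        - (+ v *ᶻ + p)               ≡⟨ ℤ.neg-distribˡ-* (+ v) (+ p) ⟩
        (- + v) *ᶻ + p               ∎)
        where
        rearrange : ∀ a b → a *ᶻ (- b) - 1ℤ ≡ - (1ℤ +ᶻ b *ᶻ a)
        rearrange = solve-∀
      signed : ∀ z → ∃[ y ] + p ∣ + ∣ z ∣ᶻ *ᶻ y - 1ℤ → ∃[ y ] + p ∣ z *ᶻ y - 1ℤ
      signed (+ m)    r       = r
      signed -[1+ m ] (y , d) = - y , subst (λ z → + p ∣ z - 1ℤ) (flip (+ suc m) y) d
        where
        flip : ∀ a b → a *ᶻ b ≡ (- a) *ᶻ (- b)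
        flip = solve-∀

  opaque
    -- Adding the odd number `p` flips the parity and keeps the residue modulo `p`. This is the
    -- existence half of the Chinese remainder theorem for the moduli 2 and `p`.
    withParity : ∀ q x → ∃[ y ] parityℤ y ≡ q × + p ∣ y - x
    withParity q x with parityℤ x ℙ.≟ q
    ... | yes e = x , e , divides 0ℤ (ℤ.+-inverseʳ x)
    ... | no ¬e = x +ᶻ + p , flipped , divides 1ℤ (cancel x (+ p))
      where
      cancel : ∀ x y → x +ᶻ y - x ≡ 1ℤ *ᶻ y
      cancel = solve-∀
      open ≡-Reasoning
      flipped : parityℤ (x +ᶻ + p) ≡ q
      flipped = begin
        parityℤ (x +ᶻ + p)         ≡⟨ parityℤ-+ x (+ p) ⟩
        parityℤ x ℙ.+ parity p     ≡⟨ cong₂ ℙ._+_ (≢⇒≡⁻¹ ¬e) parity-p ⟩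
        q ℙ.⁻¹ ℙ.+ 1ℙ              ≡⟨ ℙ.+-comm (q ℙ.⁻¹) 1ℙ ⟩
        q ℙ.⁻¹ ℙ.⁻¹                ≡⟨ ℙ.⁻¹-involutive q ⟩
        q                          ∎

  even-diff : ∀ x y → parityℤ x ≡ parityℤ y → parityℤ (x - y) ≡ 0ℙ
  even-diff x y e rewrite parityℤ-+ x (- y) | parityℤ-neg y | e = ℙ.p+p≡0ℙ (parityℤ y)

  even-diff⁻¹ : ∀ x y → parityℤ (x - y) ≡ 0ℙ → parityℤ x ≡ parityℤ y
  even-diff⁻¹ x y e rewrite parityℤ-+ x (- y) | parityℤ-neg y with parityℤ x | parityℤ y
  ... | 0ℙ | 0ℙ = refl
  ... | 1ℙ | 1ℙ = refl

  opaque
    -- An inverse modulo `p`, adjusted to be odd, is an inverse modulo 2 as well.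
    odd∤⇒unit : ∀ {a} → parityℤ a ≡ 1ℙ → ¬ + p ∣ a → U n a
    odd∤⇒unit {a} oa p∤a with inverse a p∤a
    ... | z , d with withParity 1ℙ z
    ... | y , oy , e = y , even∧p∣⇒n∣ _ (even-diff (a *ᶻ y) 1ℤ (≡-trans (parityℤ-* a y) (cong₂ ℙ._*_ oa oy)))
                             (subst (+ p ∣_) (regroup a y z) (∣m∣n⇒∣m+n d (∣n⇒∣m*n a e)))
      where
      regroup : ∀ a y z → (a *ᶻ z - 1ℤ) +ᶻ a *ᶻ (y - z) ≡ a *ᶻ y - 1ℤ
      regroup = solve-∀

  unit⇒odd : ∀ {a} → U n a → parityℤ a ≡ 1ℙ
  unit⇒odd {a} (y , d) with even-diff⁻¹ (a *ᶻ y) 1ℤ (2∣⇒evenℤ (∣-trans 2∣n d))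
  ... | e rewrite parityℤ-* a y with parityℤ a
  ... | 1ℙ = refl

  unit⇒∤ : ∀ {a} → U n a → ¬ + p ∣ a
  unit⇒∤ {a} (y , d) p∣a = p∤1 (subst (+ p ∣_) (cancel (a *ᶻ y)) (∣m∣n⇒∣m-n (∣m⇒∣m*n y p∣a) (∣-trans p∣n d)))
    where
    cancel : ∀ z → z - (z - 1ℤ) ≡ 1ℤ
    cancel = solve-∀

  unit-1 : U n 1ℤ
  unit-1 = 1ℤ , divides 0ℤ refl

  unit--1 : U n -1ℤ
  unit--1 = -1ℤ , divides 0ℤ refl

  opaque
    -- The quotient of `y` by `x` modulo `p` is lifted to an odd integer `a`. It is prime to `p`
    -- because `y` is, hence a unit modulo `n`.
    unit-quotient : ∀ {x y} → ¬ + p ∣ x → ¬ + p ∣ y → ∃[ a ] U n a × + p ∣ a *ᶻ x - y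
    unit-quotient {x} {y} p∤x p∤y with inverse x p∤x
    ... | z , d with withParity 1ℙ (z *ᶻ y)
    ... | a , oa , e = a , odd∤⇒unit oa p∤a , ax≡y
      where
      regroup : ∀ a x y z → (a - z *ᶻ y) *ᶻ x +ᶻ (x *ᶻ z - 1ℤ) *ᶻ y ≡ a *ᶻ x - y
      regroup = solve-∀
      cancel : ∀ z y → z - (z - y) ≡ y
      cancel = solve-∀
      ax≡y : + p ∣ a *ᶻ x - y
      ax≡y = subst (+ p ∣_) (regroup a x y z) (∣m∣n⇒∣m+n (∣m⇒∣m*n x e) (∣m⇒∣m*n y d))
      p∤a : ¬ + p ∣ a
      p∤a p∣a = p∤y (subst (+ p ∣_) (cancel (a *ᶻ x) y) (∣m∣n⇒∣m-n (∣m⇒∣m*n x p∣a) ax≡y))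

  -- Zero sums and the residues of their terms modulo 2 and p

  opaque
    χ : ℤ → ℕ
    χ x = if does (+ p ∣? x) then 0 else 1

    χ-∣ : ∀ {x} → + p ∣ x → χ x ≡ 0
    χ-∣ {x} d = cong (λ b → if b then 0 else 1) (dec-true (+ p ∣? x) d)

    χ-∤ : ∀ {x} → ¬ + p ∣ x → χ x ≡ 1
    χ-∤ {x} ¬d = cong (λ b → if b then 0 else 1) (dec-false (+ p ∣? x) ¬d)

  support : Sequence → ℕ
  support S = sumᴺ (χ ∘ lookup S)

  χ-cases : ∀ x → (+ p ∣ x × χ x ≡ 0) ⊎ (¬ (+ p ∣ x) × χ x ≡ 1)
  χ-cases x with + p ∣? x
  ... | yes d = inj₁ (d , χ-∣ d)
  ... | no ¬d = inj₂ (¬d , χ-∤ ¬d)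

  χ≡0⇒∣ : ∀ {x} → χ x ≡ 0 → + p ∣ x
  χ≡0⇒∣ {x} e with χ-cases x
  ... | inj₁ (d , _) = d
  ... | inj₂ (_ , e′) with () ← ≡-trans (sym e) e′

  χ≡1⇒∤ : ∀ {x} → χ x ≡ 1 → ¬ + p ∣ x
  χ≡1⇒∤ {x} e d with () ← ≡-trans (sym e) (χ-∣ d)

  -- By the Chinese remainder theorem these two invariants determine the orbit
  -- of x under U n.
  infix 4 _∼_
  _∼_ : ℤ → ℤ → Set
  x ∼ y = parityℤ x ≡ parityℤ y × χ x ≡ χ y

  ∼-setoid : Setoid 0ℓ 0ℓ
  ∼-setoid = record
    { _≈_ = _∼_
    ; isEquivalence = record
      { refl  = refl , refl
      ; sym   = λ (e , f) → sym e , sym f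
      ; trans = λ (e , f) (e′ , f′) → ≡-trans e e′ , ≡-trans f f′
      }
    }

  -- Units are odd, so modulo 2 the weight `a` disappears and equal parities suffice. The factor
  -- `1ℤ` stands where `Equivalent` expects the scalar `c`.
  congruent : ∀ {a x y} → U n a → parityℤ x ≡ parityℤ y → + p ∣ a *ᶻ x - y → 1ℤ *ᶻ y ≡ a *ᶻ x [mod n ]
  congruent {a} {x} {y} ua e d =
    even∧p∣⇒n∣ (1ℤ *ᶻ y - a *ᶻ x) (even-diff (1ℤ *ᶻ y) (a *ᶻ x) parities)
      (subst (+ p ∣_) (swap-diff (a *ᶻ x) y) (∣m⇒∣-m d))
    where
    swap-diff : ∀ u y → - (u - y) ≡ 1ℤ *ᶻ y - u
    swap-diff = solve-∀
    open ≡-Reasoning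
    parities : parityℤ (1ℤ *ᶻ y) ≡ parityℤ (a *ᶻ x)
    parities = begin
      parityℤ (1ℤ *ᶻ y)          ≡⟨ parityℤ-* 1ℤ y ⟩
      parityℤ y                  ≡⟨ e ⟨
      parityℤ x                  ≡⟨ cong (ℙ._* parityℤ x) (unit⇒odd {a} ua) ⟨
      parityℤ a ℙ.* parityℤ x    ≡⟨ parityℤ-* a x ⟨
      parityℤ (a *ᶻ x)           ∎

  private module ∼ = Permutationₛ ∼-setoid
  open ∼ using () renaming (_↭_ to _↭∼_)

  -- If `p` divides `x`, it divides `y` too and the weight 1 will do; otherwise the weight comes
  -- from `unit-quotient`.
  ∼⇒multiple : ∀ {x y} → x ∼ y → ∃[ a ] U n a × 1ℤ *ᶻ y ≡ a *ᶻ x [mod n ]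
  ∼⇒multiple {x} {y} (e , f) with χ-cases x
  ... | inj₁ (p∣x , χx) = 1ℤ , unit-1 , congruent {1ℤ} {x} {y} unit-1 e
          (∣m∣n⇒∣m-n (∣n⇒∣m*n 1ℤ {x} p∣x) (χ≡0⇒∣ {y} (≡-trans (sym f) χx)))
  ... | inj₂ (p∤x , χx) with unit-quotient {x} {y} p∤x (χ≡1⇒∤ {y} (≡-trans (sym f) χx))
  ...   | a , ua , d = a , ua , congruent {a} {x} {y} ua e d

  -- Units modulo `n` are odd and prime to `p`, so multiplying by `a` or `c` changes neither
  -- invariant.
  multiple⇒∼ : ∀ {a c x y} → U n a → U n c → c *ᶻ y ≡ a *ᶻ x [mod n ] → x ∼ y
  multiple⇒∼ {a} {c} {x} {y} ua uc d = parities , supports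
    where
    odd-* : ∀ {u} v → U n u → parityℤ (u *ᶻ v) ≡ parityℤ v
    odd-* {u} v uu = ≡-trans (parityℤ-* u v) (cong (ℙ._* parityℤ v) (unit⇒odd {u} uu))
    parities : parityℤ x ≡ parityℤ y
    parities = begin
      parityℤ x          ≡⟨ odd-* {a} x ua ⟨
      parityℤ (a *ᶻ x)   ≡⟨ even-diff⁻¹ (c *ᶻ y) (a *ᶻ x) (2∣⇒evenℤ (∣-trans 2∣n d)) ⟨
      parityℤ (c *ᶻ y)   ≡⟨ odd-* {c} y uc ⟩
      parityℤ y          ∎
      where open ≡-Reasoning
    p∣cy-ax : + p ∣ c *ᶻ y - a *ᶻ x
    p∣cy-ax = ∣-trans p∣n d
    cancel : ∀ u v → u - (u - v) ≡ v
    cancel = solve-∀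
    restore : ∀ u v → (u - v) +ᶻ v ≡ u
    restore = solve-∀
    ∣x⇒∣y : + p ∣ x → + p ∣ y
    ∣x⇒∣y p∣x with euclid c y (subst (+ p ∣_) (restore (c *ᶻ y) (a *ᶻ x)) (∣m∣n⇒∣m+n p∣cy-ax (∣n⇒∣m*n a p∣x)))
    ... | inj₁ p∣c = contradiction p∣c (unit⇒∤ {c} uc)
    ... | inj₂ p∣y = p∣y
    ∣y⇒∣x : + p ∣ y → + p ∣ x
    ∣y⇒∣x p∣y with euclid a x (subst (+ p ∣_) (cancel (c *ᶻ y) (a *ᶻ x)) (∣m∣n⇒∣m-n (∣n⇒∣m*n c p∣y) p∣cy-ax))
    ... | inj₁ p∣a = contradiction p∣a (unit⇒∤ {a} ua)
    ... | inj₂ p∣x = p∣x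
    supports : χ x ≡ χ y
    supports with χ-cases x
    ... | inj₁ (p∣x , χx) = ≡-trans χx (sym (χ-∣ (∣x⇒∣y p∣x)))
    ... | inj₂ (p∤x , χx) = ≡-trans χx (sym (χ-∤ (p∤x ∘ ∣y⇒∣x)))

  -- The scalar `c` can be 1, because the weights are chosen separately for each term.
  ↭∼⇒equivalent : ∀ {S T} → S ↭∼ T → Equivalent n (U n) S T
  ↭∼⇒equivalent {S} {T} π =
    1ℤ , unit-1 , onIndices π , proj₁ ∘ weights , proj₁ ∘ proj₂ ∘ weights , proj₂ ∘ proj₂ ∘ weights
    where
    weights = λ i → ∼⇒multiple (Permutationₛ′.onIndices-lookup ∼-setoid π i)

  module _ {S T : Sequence} (σ : Permutation (length S) (length T))
           (σ∼ : ∀ i → lookup S i ∼ lookup T (σ ⟨$⟩ʳ i)) where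

    parityΣ-permute : parityΣ S ≡ parityΣ T
    parityΣ-permute = ≡-trans (sumᴾ-cong (proj₁ ∘ σ∼)) (sym (sumᴾ-permute (parityℤ ∘ lookup T) σ))

    support-permute : support S ≡ support T
    support-permute = ≡-trans (sumᴺ-cong (proj₂ ∘ σ∼)) (sym (sumᴺ-permute (χ ∘ lookup T) σ))

  parityΣ-↭ : ∀ {S T} → S ↭ T → parityΣ S ≡ parityΣ T
  parityΣ-↭ {S} {T} π = parityΣ-permute {S} {T} (onIndices π′) (Permutationₛ′.onIndices-lookup ∼-setoid π′)
    where π′ = ↭⇒↭ₛ′ (Setoid.isEquivalence ∼-setoid) π

  support-↭ : ∀ {S T} → S ↭ T → support S ≡ support T
  support-↭ {S} {T} π = support-permute {S} {T} (onIndices π′) (Permutationₛ′.onIndices-lookup ∼-setoid π′)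
    where π′ = ↭⇒↭ₛ′ (Setoid.isEquivalence ∼-setoid) π

  -- Every term of the list receives a weight, so that choosing a subsequence and weighting it
  -- become separate tasks. The index keeps only the value of the combination.
  data UnitCombination : Sequence → ℤ → Set where
    []  : UnitCombination [] 0ℤ
    term : ∀ a {x T s} → U n a → UnitCombination T s → UnitCombination (x ∷ T) (a *ᶻ x +ᶻ s)

  -- All weights are odd, so they disappear modulo 2.
  parity-combination : ∀ {T s} → UnitCombination T s → parityℤ s ≡ parityΣ T
  parity-combination []                           = refl
  parity-combination (term a {x} {T} {s} ua c)
    rewrite parityℤ-+ (a *ᶻ x) s | parityℤ-* a x | unit⇒odd {a} ua = cong (parityℤ x ℙ.+_) (parity-combination c)

  ∣-combination : ∀ {T s} → support T ≡ 0 → UnitCombination T s → + p ∣ s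
  ∣-combination _ [] = divides 0ℤ refl
  ∣-combination e (term a {x} ua c) =
    ∣m∣n⇒∣m+n (∣n⇒∣m*n a (χ≡0⇒∣ (ℕ.m+n≡0⇒m≡0 (χ x) e))) (∣-combination (ℕ.m+n≡0⇒n≡0 (χ x) e) c)

  -- Modulo `p` a single summand survives, and it is a product of two factors prime to `p`.
  ∤-combination : ∀ {T s} → support T ≡ 1 → UnitCombination T s → ¬ + p ∣ s
  ∤-combination e (term a {x} {T} {s} ua c) d with χ-cases x
  ... | inj₁ (p∣x , χx) rewrite χx = ∤-combination e c (∣m+n∣m⇒∣n d (∣n⇒∣m*n a p∣x))
  ... | inj₂ (p∤x , χx) rewrite χx =
    [ unit⇒∤ {a} ua , p∤x ] (euclid a x (∣m+n∣n⇒∣m d (∣-combination (ℕ.suc-injective e) c)))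

  combination : ∀ T → ∃ (UnitCombination T)
  combination []      = 0ℤ , []
  combination (x ∷ T) with combination T
  ... | s , c = 1ℤ *ᶻ x +ᶻ s , term 1ℤ unit-1 c

  -- At the first of several terms prime to p, one of the weights 1 and -1 leaves
  -- a remainder prime to p, because p is odd.
  combination-∤ : ∀ T r {k} → support T ≡ suc k → ¬ + p ∣ r →
                  ∃[ s ] UnitCombination T s × + p ∣ s - r
  combination-∤ (x ∷ T) r e p∤r with χ-cases x
  combination-∤ (x ∷ T) r e p∤r | inj₁ (p∣x , χx) rewrite χx with combination-∤ T r e p∤r
  ... | s , c , d = _ , term 1ℤ unit-1 c , subst (+ p ∣_) (regroup x s r) (∣m∣n⇒∣m+n p∣x d)
    where
    regroup : ∀ x s r → x +ᶻ (s - r) ≡ 1ℤ *ᶻ x +ᶻ s - r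
    regroup = solve-∀
  combination-∤ (x ∷ T) r e p∤r | inj₂ (p∤x , χx) with support T in eq
  -- No later term is prime to `p`, so `x` alone must supply the residue `r`; the remaining weights
  -- may be arbitrary units.
  ... | zero  with combination T | unit-quotient {x} {r} p∤x p∤r
  ...   | s , c | a , ua , d = _ , term a ua c , subst (+ p ∣_) (regroup (a *ᶻ x) s r) (∣m∣n⇒∣m+n d (∣-combination eq c))
    where
    regroup : ∀ x s r → (x - r) +ᶻ s ≡ x +ᶻ s - r
    regroup = solve-∀
  combination-∤ (x ∷ T) r e p∤r | inj₂ (p∤x , χx) | suc k with + p ∣? (r - x)
  ... | no p∤r-x with combination-∤ T (r - x) eq p∤r-x
  ...   | s , c , d = _ , term 1ℤ unit-1 c , subst (+ p ∣_) (regroup x s r) d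
    where
    regroup : ∀ x s r → s - (r - x) ≡ 1ℤ *ᶻ x +ᶻ s - r
    regroup = solve-∀
  combination-∤ (x ∷ T) r e p∤r | inj₂ (p∤x , χx) | suc k | yes p∣r-x
    with combination-∤ T (r +ᶻ x) eq p∤r+x
    where
    double : ∀ r x → (r +ᶻ x) +ᶻ (r - x) ≡ + 2 *ᶻ r
    double = solve-∀
    p∤r+x : ¬ + p ∣ r +ᶻ x
    p∤r+x d = [ p∤2 , p∤r ] (euclid (+ 2) r (subst (+ p ∣_) (double r x) (∣m∣n⇒∣m+n d p∣r-x)))
  ... | s , c , d = _ , term -1ℤ unit--1 c , subst (+ p ∣_) (regroup x s r) d
    where
    regroup : ∀ x s r → s - (r +ᶻ x) ≡ -1ℤ *ᶻ x +ᶻ s - r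
    regroup = solve-∀

  -- `combination-∤` reaches only targets prime to `p`. So the first term `x` prime to `p` gets
  -- weight 1, and the terms after it, which include another one prime to `p`, are made to reach
  -- `- x`.
  combination-0 : ∀ T → support T ≢ 1 → ∃[ s ] UnitCombination T s × + p ∣ s
  combination-0 [] _ = _ , [] , divides 0ℤ refl
  combination-0 (x ∷ T) ≢1 with χ-cases x
  combination-0 (x ∷ T) ≢1 | inj₁ (p∣x , χx) rewrite χx with combination-0 T ≢1
  ... | s , c , d = _ , term 1ℤ unit-1 c , ∣m∣n⇒∣m+n (∣n⇒∣m*n 1ℤ p∣x) d
  combination-0 (x ∷ T) ≢1 | inj₂ (p∤x , χx) rewrite χx with support T in eq
  ... | zero  = contradiction refl ≢1
  ... | suc k with combination-∤ T (- x) eq (p∤x ∘ subst (+ p ∣_) (ℤ.neg-involutive x) ∘ ∣m⇒∣-m)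
  ...   | s , c , d = _ , term 1ℤ unit-1 c , subst (+ p ∣_) (regroup x s) d
    where
    regroup : ∀ x s → s - (- x) ≡ 1ℤ *ᶻ x +ᶻ s
    regroup = solve-∀

  -- The sequences with a combination by units that vanishes modulo n.
  record ZeroSum (T : Sequence) : Set where
    constructor zeroSum
    field
      even  : parityΣ T ≡ 0ℙ
      ≢1    : support T ≢ 1

  combination⇒zeroSum : ∀ {T s} → UnitCombination T s → + n ∣ s → ZeroSum T
  combination⇒zeroSum c d = zeroSum
    (≡-trans (sym (parity-combination c)) (2∣⇒evenℤ (∣-trans 2∣n d)))
    (λ e → ∤-combination e c (∣-trans p∣n d))

  zeroSum⇒combination : ∀ {T} → ZeroSum T → ∃[ s ] UnitCombination T s × + n ∣ s
  zeroSum⇒combination {T} (zeroSum e ≢1) with combination-0 T ≢1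
  ... | s , c , d = s , c , even∧p∣⇒n∣ s (≡-trans (parity-combination c) e) d

  zeroSum-↭ : ∀ {S T} → S ↭ T → ZeroSum S → ZeroSum T
  zeroSum-↭ π (zeroSum e ≢1) = zeroSum (≡-trans (sym (parityΣ-↭ π)) e) (≢1 ∘ ≡-trans (support-↭ π))

  -- From index sets to splittings of a list

  restrict : ∀ S (I : Subset (length S)) (a : Fin (length S) → ℤ) → (∀ i → i ∈ˢ I → U n (a i)) →
             ∃[ R ] ∃[ T ] S ↭ R ++ T × length T ≡ size I ×
               UnitCombination T (sumOver I λ i → a i *ᶻ lookup S i)
  restrict [] Vec.[] a ua = [] , [] , refl , refl , []
  restrict (x ∷ S) (inside Vec.∷ I) a ua with restrict S I (a ∘ suc) (λ i → ua (suc i) ∘ Vec.there)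
  ... | R , T , π , len , c =
    R , x ∷ T , ↭-trans (prep x π) (↭-sym (shift x R T)) , cong suc len , term (a zero) (ua zero Vec.here) c
  restrict (x ∷ S) (outside Vec.∷ I) a ua with restrict S I (a ∘ suc) (λ i → ua (suc i) ∘ Vec.there)
  ... | R , T , π , len , c =
    x ∷ R , T , prep x π , len , subst (UnitCombination T) (sym (ℤ.+-identityˡ _)) c

  extend : ∀ {T S s} → T ⊆ S → UnitCombination T s →
           ∃[ I ] ∃ λ (a : Fin (length S) → ℤ) → size I ≡ length T × (∀ i → i ∈ˢ I → U n (a i)) ×
             sumOver I (λ i → a i *ᶻ lookup S i) ≡ s
  extend [] [] = Vec.[] , (λ ()) , refl , (λ ()) , refl
  extend {S = _ ∷ S} (y ∷ʳ τ) c with extend τ c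
  ... | I , a , len , ua , e = outside Vec.∷ I , a′ , len , (λ where (suc i) (Vec.there i∈I) → ua i i∈I) ,
                               ≡-trans (ℤ.+-identityˡ _) e
    where
    a′ : Fin (suc (length S)) → ℤ
    a′ zero    = 0ℤ
    a′ (suc i) = a i
  extend {S = x ∷ S} (refl ∷ τ) (term b ub c) with extend τ c
  ... | I , a , len , ua , e = inside Vec.∷ I , a′ , cong suc len ,
                               (λ where zero _ → ub
                                        (suc i) (Vec.there i∈I) → ua i i∈I) ,
                               cong (b *ᶻ x +ᶻ_) e
    where
    a′ : Fin (suc (length S)) → ℤ
    a′ zero    = b
    a′ (suc i) = a i

  -- Here `R` holds the deleted terms and `T` the chosen ones. The combinatorial arguments below use
  -- this form, in which positions and weights no longer occur.
  HasZeroSum : Sequence → Set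
  HasZeroSum S = ∃[ R ] ∃[ T ] S ↭ R ++ T × length T ≡ n × ZeroSum T

  weighted⇒zeroSum : ∀ {S} → HasWeightedZeroSumOfLength n (U n) n S → HasZeroSum S
  weighted⇒zeroSum {S} (I , len , _ , a , ua , d) with restrict S I a ua
  ... | R , T , π , len′ , c = R , T , π , ≡-trans len′ len , combination⇒zeroSum c (subst (+ n ∣_) (ℤ.+-identityʳ _) d)

  -- The splitting forgets positions, but an index set needs them. Carrying `T` back along the
  -- permutation gives a true sublist `T′` of `S`, which is still a zero sum since `ZeroSum` ignores
  -- order.
  zeroSum⇒weighted : ∀ {S} → HasZeroSum S → HasWeightedZeroSumOfLength n (U n) n S
  zeroSum⇒weighted {S} (R , T , π , len , z) with ⊆-resp-↭ (Sublist.++⁺ˡ R ⊆-refl) (↭-sym π)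
  ... | T′ , T′⊆S , π′ with zeroSum⇒combination (zeroSum-↭ π′ z)
  ... | s , c , d with extend T′⊆S c
  ... | I , a , lenI , ua , e = I , size≡n , size>0⇒nonempty I (subst (0 ℕ.<_) (sym size≡n) 0<n) , a , ua ,
                                subst (+ n ∣_) (≡-trans (sym e) (sym (ℤ.+-identityʳ _))) d
    where
    size≡n = ≡-trans lenI (≡-trans (sym (↭-length π′)) len)

  -- The Gao constant

  ↭⇒↭∼ : ∀ {S T} → S ↭ T → S ↭∼ T
  ↭⇒↭∼ = ↭⇒↭ₛ′ (Setoid.isEquivalence ∼-setoid)

  2<n : 2 ℕ.< n
  2<n rewrite n≡2p = ℕ.+-mono-≤ 1<p (ℕ.≤-trans (ℕ.<⇒≤ 1<p) (ℕ.m≤m+n p 0))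
    where 1<p = ℕ.nonTrivial⇒n>1 p {{prime⇒nonTrivial p-prime}}

  parity-1+n : parity (suc n) ≡ 1ℙ
  parity-1+n rewrite parity-suc n | parity-n = refl

  parity-pred : ∀ {m} → suc m ≡ n → parity m ≡ 1ℙ
  parity-pred {m} refl = ≡-trans (sym (suc-homo-⁻¹ m)) (cong ℙ._⁻¹ parity-n)

  χ≡0∨1 : ∀ x → χ x ≡ 0 ⊎ χ x ≡ 1
  χ≡0∨1 x with χ-cases x
  ... | inj₁ (_ , e) = inj₁ e
  ... | inj₂ (_ , e) = inj₂ e

  support≡0 : ∀ {S} → All (λ z → χ z ≡ 0) S → support S ≡ 0
  support≡0 []       = refl
  support≡0 (e ∷ es) = cong₂ _+_ e (support≡0 es)

  support≡0⁻ : ∀ S → support S ≡ 0 → All (λ z → χ z ≡ 0) S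
  support≡0⁻ []      e = []
  support≡0⁻ (x ∷ S) e = ℕ.m+n≡0⇒m≡0 (χ x) e ∷ support≡0⁻ S (ℕ.m+n≡0⇒n≡0 (χ x) e)

  extract-∤ : ∀ S {k} → support S ≡ suc k → ∃[ x ] ∃[ T ] S ↭ x ∷ T × χ x ≡ 1 × support T ≡ k
  extract-∤ (x ∷ S) e with χ≡0∨1 x
  ... | inj₂ χx = x , S , refl , χx , ℕ.suc-injective (≡-trans (cong (_+ support S) (sym χx)) e)
  ... | inj₁ χx with extract-∤ S (≡-trans (cong (_+ support S) (sym χx)) e)
  ...   | y , T , π , χy , e′ = y , x ∷ T , trans (prep x π) (swap x y refl) , χy , cong₂ _+_ χx e′

  length-tail : ∀ {S T : Sequence} {x m} → S ↭ x ∷ T → length S ≡ suc m → length T ≡ m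
  length-tail π len = ℕ.suc-injective (≡-trans (sym (↭-length π)) len)

  hasZeroSum-∷ : ∀ {x S T} → S ↭ x ∷ T → HasZeroSum T → HasZeroSum S
  hasZeroSum-∷ {x} π (R , T , ρ , len , z) = x ∷ R , T , trans π (prep x ρ) , len , z

  remove⇒hasZeroSum : ∀ {x S T} → length S ≡ suc n → S ↭ x ∷ T → parityℤ x ≡ parityΣ S → support T ≢ 1 → HasZeroSum S
  remove⇒hasZeroSum {x} {S} {T} len π e ≢1 = x ∷ [] , T , π , length-tail π len , zeroSum even ≢1
    where
    even : parityΣ T ≡ 0ℙ
    even = ℙ.+-cancelˡ-≡ (parityℤ x) (parityΣ T) 0ℙ
      (≡-trans (sym (parityΣ-↭ π)) (≡-trans (sym e) (sym (ℙ.+-identityʳ _))))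

  -- A deletion lowers the support by at most one, so the forbidden value 1 could only arise from 1
  -- or 2. A term with the parity of the sum exists: otherwise all terms share the opposite parity,
  -- and so does their sum, the length being odd.
  support≢1,2⇒hasZeroSum : ∀ S → length S ≡ suc n → support S ≢ 1 → support S ≢ 2 → HasZeroSum S
  support≢1,2⇒hasZeroSum S len ≢1 ≢2 with select-parity (parityΣ S) S
  ... | inj₂ all = contradiction (odd⇒parityΣ-constant (≡-trans (cong parity len) parity-1+n) all) (ℙ.p≢p⁻¹ _)
  ... | inj₁ (z , T , e , π) = remove⇒hasZeroSum len π e ≢1′
    where
    ≢1′ : support T ≢ 1
    ≢1′ sT with χ≡0∨1 z
    ... | inj₁ χz = ≢1 (≡-trans (support-↭ π) (cong₂ _+_ χz sT))
    ... | inj₂ χz = ≢2 (≡-trans (support-↭ π) (cong₂ _+_ χz sT))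

  -- A partner for the first term `a` is sought among the others. If none exists, the others all
  -- have one parity; there are `n ∸ 1` of them, an odd number, so the odd total forces `q` to be
  -- even, and any two of them form the pair.
  pairWithParity : ∀ q R → length R ≡ n → parityΣ R ≡ 1ℙ →
                   ∃[ z ] ∃[ w ] ∃[ T ] R ↭ z ∷ w ∷ T × parityℤ z ℙ.+ parityℤ w ≡ q
  pairWithParity q []               len e with () ← subst (2 ℕ.<_) (sym len) 2<n
  pairWithParity q (a ∷ [])         len e with ℕ.s≤s () ← subst (2 ℕ.<_) (sym len) 2<n
  pairWithParity q (a ∷ b ∷ [])     len e with ℕ.s≤s (ℕ.s≤s ()) ← subst (2 ℕ.<_) (sym len) 2<n
  pairWithParity q (a ∷ R@(b ∷ c ∷ T)) len e with select-parity (parityℤ a ℙ.+ q) R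
  ... | inj₁ (w , T′ , w≡ , π) = a , w , T′ , prep a π ,
        ≡-trans (cong (parityℤ a ℙ.+_) w≡) (cancel (parityℤ a) q)
    where
    cancel : ∀ a q → a ℙ.+ (a ℙ.+ q) ≡ q
    cancel 0ℙ q = refl
    cancel 1ℙ q = ℙ.⁻¹-involutive q
  ... | inj₂ all@(b≡ ∷ c≡ ∷ _) = b , c , a ∷ T , trans (swap a b refl) (prep b (swap a c refl)) ,
        ≡-trans (cong₂ ℙ._+_ b≡ c≡) (≡-trans (ℙ.p+p≡0ℙ ((parityℤ a ℙ.+ q) ℙ.⁻¹)) (sym q≡0))
    where
    solve : ∀ a q → a ℙ.+ (a ℙ.+ q) ℙ.⁻¹ ≡ 1ℙ → q ≡ 0ℙ
    solve 0ℙ 0ℙ _ = refl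
    solve 1ℙ 0ℙ _ = refl
    q≡0 : q ≡ 0ℙ
    q≡0 = solve (parityℤ a) q
      (≡-trans (cong (parityℤ a ℙ.+_) (sym (odd⇒parityΣ-constant {S = R} (parity-pred len) all))) e)

  support≡2⇒hasZeroSum : ∀ {x y R S} → S ↭ x ∷ y ∷ R → χ x ≡ 1 → χ y ≡ 1 → support R ≡ 0 →
                         length R ≡ n → HasZeroSum S
  support≡2⇒hasZeroSum {x} {y} {R} π χx χy sR len with parityΣ R in eR
  ... | 0ℙ = x ∷ y ∷ [] , R , π , len , zeroSum eR (λ sR′ → case ≡-trans (sym sR) sR′ of λ ())
  -- As `R` is odd, the target is the parity of the whole sequence: deleting such a pair leaves an
  -- even sum, in which `x` and `y` keep the support at 2.
  ... | 1ℙ with pairWithParity ((parityℤ x ℙ.+ parityℤ y) ℙ.⁻¹) R len eR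
  ...   | z , w , T , ρ , zw = z ∷ w ∷ [] , x ∷ y ∷ T ,
          trans π (trans (prep x (prep y ρ)) (shifts (x ∷ y ∷ []) (z ∷ w ∷ []))) ,
          ≡-trans (sym (↭-length ρ)) len , zeroSum even ≢1
    where
    even : parityΣ (x ∷ y ∷ T) ≡ 0ℙ
    even = solve (parityℤ x) (parityℤ y) (parityℤ z) (parityℤ w) (parityΣ T) zw (≡-trans (sym (parityΣ-↭ ρ)) eR)
      where
      solve : ∀ x y z w t → z ℙ.+ w ≡ (x ℙ.+ y) ℙ.⁻¹ → z ℙ.+ (w ℙ.+ t) ≡ 1ℙ → x ℙ.+ (y ℙ.+ t) ≡ 0ℙ
      solve x y z w t e f with ≡-trans (ℙ.+-assoc z w t) f
      ... | g rewrite e | sym (ℙ.+-assoc x y t) with x ℙ.+ y | t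
      ... | 0ℙ | 0ℙ = refl
      ... | 1ℙ | 1ℙ = refl
    ≢1 : support (x ∷ y ∷ T) ≢ 1
    ≢1 e rewrite χx | χy with () ← e

  -- One deletion should reach length `n + 1` with support neither 1 nor 2. For support 1 or at
  -- least 4 a term prime to `p` is deleted, for support 3 a multiple of `p`, and for support 0 any
  -- term. Support 2 admits no such deletion and is treated directly.
  length-2+n⇒hasZeroSum : ∀ S → length S ≡ suc (suc n) → HasZeroSum S
  length-2+n⇒hasZeroSum S len with support S in s
  length-2+n⇒hasZeroSum (x ∷ S) len | zero =
    hasZeroSum-∷ refl (support≢1,2⇒hasZeroSum S (ℕ.suc-injective len) (λ e → ≢0 e) (λ e → ≢0 e))
    where
    ≢0 : ∀ {k} → support S ≢ suc k
    ≢0 e with () ← ≡-trans (sym e) (ℕ.m+n≡0⇒n≡0 (χ x) s)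
  ... | suc k with extract-∤ S s
  ... | x , T , π , χx , sT with k
  ... | 0 = hasZeroSum-∷ π (support≢1,2⇒hasZeroSum T (length-tail π len)
              (λ e → case ≡-trans (sym sT) e of λ ()) (λ e → case ≡-trans (sym sT) e of λ ()))
  ... | suc (suc (suc k)) = hasZeroSum-∷ π (support≢1,2⇒hasZeroSum T (length-tail π len)
              (λ e → case ≡-trans (sym sT) e of λ ()) (λ e → case ≡-trans (sym sT) e of λ ()))
  ... | 1 with extract-∤ T sT
  ... | y , R , ρ , χy , sR =
    support≡2⇒hasZeroSum (trans π (prep x ρ)) χx χy sR (length-tail ρ (length-tail π len))
  length-2+n⇒hasZeroSum S len | suc k | x , T , π , χx , sT | 2 with extract-∤ T sT
  ... | y , R , ρ , χy , sR with extract-∤ R sR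
  ... | w , [] , σ , χw , sQ with ℕ.s≤s () ← subst (2 ℕ.<_) (≡-trans (sym (length-tail ρ (length-tail π len))) (↭-length σ)) 2<n
  ... | w , z ∷ Q , σ , χw , sQ =
    hasZeroSum-∷ τ (support≢1,2⇒hasZeroSum (x ∷ y ∷ w ∷ Q) (length-tail τ len) (≢ λ ()) (≢ λ ()))
    where
    τ : S ↭ z ∷ x ∷ y ∷ w ∷ Q
    τ = trans π (trans (prep x (trans ρ (prep y σ))) (shift z (x ∷ y ∷ w ∷ []) Q))
    s≡3 : support (x ∷ y ∷ w ∷ Q) ≡ 3
    s≡3 rewrite χx | χy | χw = cong (λ k → 3 + k) (ℕ.m+n≡0⇒n≡0 (χ z) sQ)
    ≢ : ∀ {k} → 3 ≢ k → support (x ∷ y ∷ w ∷ Q) ≢ k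
    ≢ 3≢k e = 3≢k (≡-trans (sym s≡3) e)

  -- No term can be deleted from a blocked sequence to leave a zero sum: deleting
  -- z leaves an even sum only if z has the parity of S, and then exactly one
  -- term prime to p remains.
  Blocked : Sequence → Set
  Blocked S = All (λ z → parityℤ z ≡ parityΣ S → support S ≡ suc (χ z)) S

  -- Counting lengths leaves one deleted term `z`. It has the parity of `S` because the rest is
  -- even, so blockedness gives the rest support 1.
  blocked⇒¬hasZeroSum : ∀ {S} → length S ≡ suc n → Blocked S → ¬ HasZeroSum S
  blocked⇒¬hasZeroSum {S} len blocked (R , T , π , lenT , zeroSum even ≢1) = single R π length-R
    where
    length-R : length R ≡ 1
    length-R = ℕ.+-cancelʳ-≡ n (length R) 1 (begin
      length R + n         ≡⟨ cong (λ k → length R + k) lenT ⟨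
      length R + length T  ≡⟨ List.length-++ R ⟨
      length (R ++ T)      ≡⟨ ↭-length π ⟨
      length S             ≡⟨ len ⟩
      suc n                ∎)
      where open ≡-Reasoning
    single : ∀ R → S ↭ R ++ T → length R ≡ 1 → ⊥
    single (z ∷ []) π _ = ≢1 (ℕ.+-cancelˡ-≡ (χ z) (support T) 1 (begin
      χ z + support T  ≡⟨ support-↭ π ⟨
      support S        ≡⟨ All.lookup blocked (∈-resp-↭ (↭-sym π) (here refl)) e ⟩
      suc (χ z)        ≡⟨ ℕ.+-comm 1 (χ z) ⟩
      χ z + 1          ∎))
      where
      open ≡-Reasoning
      e : parityℤ z ≡ parityΣ S
      e = sym (≡-trans (parityΣ-↭ π) (≡-trans (cong (parityℤ z ℙ.+_) even) (ℙ.+-identityʳ _)))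

  equivalent-length : ∀ {S T} → Equivalent n (U n) S T → length S ≡ length T
  equivalent-length (_ , _ , σ , _) = ↔⇒≡ σ

  -- Being blocked depends only on parities and values of `χ`, which equivalence preserves term by
  -- term.
  blocked-equivalent : ∀ {S T} → Equivalent n (U n) S T → Blocked T → Blocked S
  blocked-equivalent {S} {T} (c , uc , σ , a , ua , e) blocked = All.tabulate λ z∈S →
    subst (λ z → parityℤ z ≡ parityΣ S → support S ≡ suc (χ z)) (sym (lookup-index z∈S)) (at (Any.index z∈S))
    where
    σ∼ : ∀ i → lookup S i ∼ lookup T (σ ⟨$⟩ʳ i)
    σ∼ i = multiple⇒∼ {a i} {c} {lookup S i} {lookup T (σ ⟨$⟩ʳ i)} (ua i) uc (e i)
    open ≡-Reasoning
    at : ∀ i → parityℤ (lookup S i) ≡ parityΣ S → support S ≡ suc (χ (lookup S i))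
    at i eᵢ = begin
      support S                          ≡⟨ support-permute {S} {T} σ σ∼ ⟩
      support T                          ≡⟨ All.lookup blocked (∈-lookup (σ ⟨$⟩ʳ i))
                                              (≡-trans (sym (proj₁ (σ∼ i))) (≡-trans eᵢ (parityΣ-permute {S} {T} σ σ∼))) ⟩
      suc (χ (lookup T (σ ⟨$⟩ʳ i)))      ≡⟨ cong suc (proj₂ (σ∼ i)) ⟨
      suc (χ (lookup S i))               ∎

  -- The three forms are blocked

  χ0 : χ 0ℤ ≡ 0
  χ0 = χ-∣ (divides 0ℤ refl)

  χp : χ (+ p) ≡ 0
  χp = χ-∣ ∣-refl

  χ1 : χ 1ℤ ≡ 1
  χ1 = χ-∤ p∤1

  χ2 : χ (+ 2) ≡ 1
  χ2 = χ-∤ p∤2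

  -- Since `R` is odd, `b` differs in parity from the total; deleting any other term leaves `b` as
  -- the only one prime to `p`.
  blocked-∗ : ∀ {b R} → χ b ≡ 1 → All (λ z → χ z ≡ 0) R → parityΣ R ≡ 1ℙ → Blocked (b ∷ R)
  blocked-∗ {b} {R} χb χR e = (λ e′ → contradiction (≡-trans e′ shifted) (ℙ.p≢p⁻¹ (parityℤ b))) ∷
                              All.map (λ χz _ → ≡-trans s≡1 (cong suc (sym χz))) χR
    where
    shifted : parityΣ (b ∷ R) ≡ parityℤ b ℙ.⁻¹
    shifted = ≡-trans (cong (parityℤ b ℙ.+_) e) (ℙ.+-comm (parityℤ b) 1ℙ)
    s≡1 : support (b ∷ R) ≡ 1
    s≡1 = cong₂ _+_ χb (support≡0 χR)

  -- Only `x` can have the parity of the total, and deleting it leaves `y` as the only term prime to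
  -- `p`. The value `χ x` stays open because `b₁` in (⋆) and `c` in (∗∗) may be multiples of `p`.
  blocked-pair : ∀ {x y R} → χ y ≡ 1 → All (λ z → χ z ≡ 0) R →
                 All (λ z → parityℤ z ≢ parityΣ (x ∷ y ∷ R)) (y ∷ R) → Blocked (x ∷ y ∷ R)
  blocked-pair {x} {y} {R} χy χR ≢ = (λ _ → s≡) ∷ All.map (λ ≢z e → contradiction e ≢z) ≢
    where
    s≡ : support (x ∷ y ∷ R) ≡ suc (χ x)
    s≡ = ≡-trans (cong (λ k → χ x + k) (cong₂ _+_ χy (support≡0 χR))) (ℕ.+-comm (χ x) 1)

  parityΣ-replicate-0 : ∀ k → parityΣ (replicate k 0ℤ) ≡ 0ℙ
  parityΣ-replicate-0 zero    = refl
  parityΣ-replicate-0 (suc k) = parityΣ-replicate-0 k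

  parityΣ-block : ∀ m k → parityΣ (replicate m (+ p) ++ replicate k 0ℤ) ≡ parity m
  parityΣ-block zero    k = parityΣ-replicate-0 k
  parityΣ-block (suc m) k = ≡-trans (cong₂ ℙ._+_ parity-p (parityΣ-block m k)) (sym (parity-suc m))

  parity-n∸1 : parity (n ∸ 1) ≡ 1ℙ
  parity-n∸1 = parity-pred (ℕ.m+[n∸m]≡n 0<n)

  form⋆⇒blocked : ∀ {T} → Form⋆ n p T → Blocked T
  form⋆⇒blocked (.2 , .p , inj₁ (refl , refl) , b₁ , b₂ , c₁ , c₂ , refl) =
    blocked-pair (χ-∤ λ d → [ p∤2 , coprime⇒∤ {b₂} c₂ ] (euclid (+ 2) b₂ d)) (All.replicate⁺ (n ∸ 1) χ0)
      (≢Σ (+ 2 *ᶻ b₂) even₂ ∷ All.replicate⁺ (n ∸ 1) (≢Σ 0ℤ refl))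
    where
    even₂ : parityℤ (+ 2 *ᶻ b₂) ≡ 0ℙ
    even₂ = parityℤ-* (+ 2) b₂
    Σ≡1 : parityΣ (b₁ ∷ + 2 *ᶻ b₂ ∷ replicate (n ∸ 1) 0ℤ) ≡ 1ℙ
    Σ≡1 = cong₂ ℙ._+_ (coprime-2⇒odd {b₁} c₁) (cong₂ ℙ._+_ even₂ (parityΣ-replicate-0 (n ∸ 1)))
    ≢Σ : ∀ z → parityℤ z ≡ 0ℙ → parityℤ z ≢ parityΣ (b₁ ∷ + 2 *ᶻ b₂ ∷ replicate (n ∸ 1) 0ℤ)
    ≢Σ z e e′ = case ≡-trans (sym e) (≡-trans e′ Σ≡1) of λ ()
  -- As `b₂` is odd, `+ p *ᶻ b₂` has the invariants of `p`, so this case behaves like (∗) with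
  -- `m = 1`.
  form⋆⇒blocked (.p , .2 , inj₂ (refl , refl) , b₁ , b₂ , c₁ , c₂ , refl) =
    blocked-∗ (χ-∤ (coprime⇒∤ {b₁} c₁)) (χ-∣ (∣m⇒∣m*n b₂ ∣-refl) ∷ All.replicate⁺ (n ∸ 1) χ0)
      (cong₂ ℙ._+_ (≡-trans (parityℤ-* (+ p) b₂) (cong₂ ℙ._*_ parity-p (coprime-2⇒odd {b₂} c₂))) (parityΣ-replicate-0 (n ∸ 1)))

  form∗⇒blocked : ∀ {T} → Form∗ n p T → Blocked T
  form∗⇒blocked (b , m , c , m-odd , _ , _ , refl) =
    blocked-∗ (χ-∤ (coprime⇒∤ {b} c)) (All.++⁺ (All.replicate⁺ m χp) (All.replicate⁺ (n ∸ m) χ0))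
      (≡-trans (parityΣ-block m (n ∸ m)) (Odd⇒odd m m-odd))

  form∗∗⇒blocked : ∀ {T} → Form∗∗ n p T → Blocked T
  form∗∗⇒blocked (c , 2∣c , refl) =
    blocked-pair χ1 (All.replicate⁺ (n ∸ 1) χp) (≢Σ 1ℤ refl ∷ All.replicate⁺ (n ∸ 1) (≢Σ (+ p) parity-p))
    where
    Σ≡0 : parityΣ (c ∷ 1ℤ ∷ replicate (n ∸ 1) (+ p)) ≡ 0ℙ
    Σ≡0 = cong₂ ℙ._+_ (2∣⇒evenℤ 2∣c) (cong (1ℙ ℙ.+_) (odd⇒parityΣ-constant
      (≡-trans (cong parity (List.length-replicate (n ∸ 1))) parity-n∸1) (All.replicate⁺ (n ∸ 1) parity-p)))
    ≢Σ : ∀ z → parityℤ z ≡ 1ℙ → parityℤ z ≢ parityΣ (c ∷ 1ℤ ∷ replicate (n ∸ 1) (+ p))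
    ≢Σ z e e′ = case ≡-trans (sym e) (≡-trans e′ Σ≡0) of λ ()

  Form : Sequence → Set
  Form T = Form⋆ n p T ⊎ Form∗ n p T ⊎ Form∗∗ n p T

  form⇒blocked : ∀ {T} → Form T → Blocked T
  form⇒blocked = [ form⋆⇒blocked , [ form∗⇒blocked , form∗∗⇒blocked ] ]

  -- Value of the Gao constant

  gaoProperty : GaoProperty n (U n) (suc (suc n))
  gaoProperty S len = zeroSum⇒weighted (length-2+n⇒hasZeroSum S len)

  -- This instance of (⋆) gives the lower bound for the constant and later serves as a normal form.
  canonical : Sequence
  canonical = 1ℤ ∷ + 2 ∷ replicate (n ∸ 1) 0ℤ

  canonical-form : Form⋆ n p canonical
  canonical-form = 2 , p , inj₁ (refl , refl) , 1ℤ , 1ℤ , ℕ.1-coprimeTo 2 , ℕ.1-coprimeTo p , refl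

  length-canonical : length canonical ≡ suc n
  length-canonical = cong suc (≡-trans (cong suc (List.length-replicate (n ∸ 1))) (ℕ.m+[n∸m]≡n 0<n))

  -- A zero sum in a prefix of `canonical` would be one in `canonical`, the dropped terms joining
  -- the deleted ones.
  ¬gaoProperty : ∀ {j} → j ℕ.≤ suc n → ¬ GaoProperty n (U n) j
  ¬gaoProperty {j} j≤1+n gao with weighted⇒zeroSum (gao (take j canonical) length-take)
    where
    length-take : length (take j canonical) ≡ j
    length-take = ≡-trans (List.length-take j canonical)
      (ℕ.m≤n⇒m⊓n≡m (subst (j ℕ.≤_) (sym length-canonical) j≤1+n))
  ... | R , T , π , len , z = blocked⇒¬hasZeroSum length-canonical (form⋆⇒blocked canonical-form)
        (drop j canonical ++ R , T , ρ , len , z)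
    where
    open PermutationReasoning
    ρ : canonical ↭ (drop j canonical ++ R) ++ T
    ρ = begin
      canonical                              ≡⟨ List.take++drop≡id j canonical ⟨
      take j canonical ++ drop j canonical   ↭⟨ ++-comm (take j canonical) (drop j canonical) ⟩
      drop j canonical ++ take j canonical   ↭⟨ ++⁺ˡ (drop j canonical) π ⟩
      drop j canonical ++ (R ++ T)           ≡⟨ List.++-assoc (drop j canonical) R T ⟨
      (drop j canonical ++ R) ++ T           ∎

  isGaoConstant : IsGaoConstant n (U n) (suc (suc n))
  isGaoConstant = ℕ.s≤s ℕ.z≤n , gaoProperty , λ j _ gao → ℕ.≮⇒≥ λ j<2+n → ¬gaoProperty (ℕ.≤-pred j<2+n) gao

  -- `IsGaoExtremal` only asserts that some constant exists; uniqueness fixes the length of an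
  -- extremal sequence at `n + 1`.
  gaoConstant-unique : ∀ {k} → IsGaoConstant n (U n) k → k ≡ suc (suc n)
  gaoConstant-unique (1≤k , gao , least) =
    ℕ.≤-antisym (least (suc (suc n)) (ℕ.s≤s ℕ.z≤n) gaoProperty) (proj₂ (proj₂ isGaoConstant) _ 1≤k gao)

  -- Normal forms of extremal sequences

  -- Among multiples of `p` only the parity matters: odd ones behave as `p`, even ones as 0, and `m`
  -- counts the odd ones.
  zeros-normalForm : ∀ T → support T ≡ 0 → ∃[ m ] ∃[ k ] m + k ≡ length T × parityΣ T ≡ parity m ×
                     T ↭∼ replicate m (+ p) ++ replicate k 0ℤ
  zeros-normalForm [] _ = 0 , 0 , refl , refl , ∼.↭-refl
  zeros-normalForm (x ∷ T) s with zeros-normalForm T (ℕ.m+n≡0⇒n≡0 (χ x) s) | parityℤ x in e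
  ... | m , k , len , P , π | 1ℙ = suc m , k , cong suc len , ≡-trans (cong ℙ._⁻¹ P) (sym (parity-suc m)) ,
        ∼.prep (≡-trans e (sym parity-p) , ≡-trans (ℕ.m+n≡0⇒m≡0 (χ x) s) (sym χp)) π
  ... | m , k , len , P , π | 0ℙ = m , suc k , ≡-trans (ℕ.+-suc m k) (cong suc len) , P ,
        ∼.↭-trans (∼.prep (e , ≡-trans (ℕ.m+n≡0⇒m≡0 (χ x) s) (sym χ0)) π)
                (∼.↭-sym (Permutationₛ′.↭-shift ∼-setoid (replicate m (+ p)) (replicate k 0ℤ)))

  Extremal : Sequence → Set
  Extremal S = length S ≡ suc n × ¬ HasZeroSum S

  NormalForm : Sequence → Set
  NormalForm S = ∃[ T ] Form T × S ↭∼ T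

  support≡1⇒normalForm : ∀ {S} → Extremal S → support S ≡ 1 → NormalForm S
  support≡1⇒normalForm {S} (len , ¬zs) s with extract-∤ S s
  ... | x , T , π , χx , sT with zeros-normalForm T sT
  ... | m , k , m+k , P , ρ = _ ,
    inj₂ (inj₁ (x , m , ∤⇒coprime {x} (χ≡1⇒∤ χx) , odd⇒Odd m-odd , 1≤m m m-odd , m≤n , refl)) ,
    ∼.↭-trans (↭⇒↭∼ π) (∼.↭-prep x (subst (λ k → T ↭∼ replicate m (+ p) ++ replicate k 0ℤ) k≡n∸m ρ))
    where
    m+k≡n : m + k ≡ n
    m+k≡n = ≡-trans m+k (length-tail π len)
    m≤n : m ℕ.≤ n
    m≤n = subst (m ℕ.≤_) m+k≡n (ℕ.m≤m+n m k)
    k≡n∸m : k ≡ n ∸ m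
    k≡n∸m = ≡-trans (sym (ℕ.m+n∸m≡n m k)) (cong (_∸ m) m+k≡n)
    parityΣ-T : parityΣ T ≡ 1ℙ
    parityΣ-T with parityΣ T in e
    ... | 1ℙ = refl
    -- An even `T` would itself be a zero sum of length `n`, with support 0.
    ... | 0ℙ = contradiction (x ∷ [] , T , π , length-tail π len , zeroSum e (λ e′ → case ≡-trans (sym sT) e′ of λ ())) ¬zs
    m-odd : parity m ≡ 1ℙ
    m-odd = ≡-trans (sym P) parityΣ-T
    1≤m : ∀ m → parity m ≡ 1ℙ → 1 ℕ.≤ m
    1≤m (suc m) _ = ℕ.s≤s ℕ.z≤n

  constant⇒replicate : ∀ {r R} → All (_∼ r) R → R ↭∼ replicate (length R) r
  constant⇒replicate []       = ∼.↭-refl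
  constant⇒replicate (e ∷ es) = ∼.prep e (constant⇒replicate es)

  support≡2⇒normalForm : ∀ {S} → Extremal S → support S ≡ 2 → NormalForm S
  support≡2⇒normalForm {S} (len , ¬zs) s with extract-∤ S s
  ... | x , T , π , χx , sT with extract-∤ T sT
  ... | y , R , ρ , χy , sR with select-parity (parityΣ S) R
  ... | inj₁ (z , Q , e , σ) = contradiction (remove⇒hasZeroSum len τ e s≢1) ¬zs
    where
    τ : S ↭ z ∷ x ∷ y ∷ Q
    τ = trans π (trans (prep x (trans ρ (prep y σ))) (shift z (x ∷ y ∷ []) Q))
    s≢1 : support (x ∷ y ∷ Q) ≢ 1
    s≢1 e rewrite χx | χy with () ← e
  ... | inj₂ all = normalForm (parityΣ S ℙ.⁻¹) all
    where
    1+R≡n : suc (length R) ≡ n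
    1+R≡n = ≡-trans (sym (↭-length ρ)) (length-tail π len)
    -- `R` has `n ∸ 1` terms, an odd number, all of the parity opposite to `S`, so its sum also
    -- differs from that of `S`; `x` and `y` must make up an odd difference.
    mixed : parityℤ x ℙ.+ parityℤ y ≡ 1ℙ
    mixed = solve (parityℤ x) (parityℤ y) (parityΣ S)
      (≡-trans (parityΣ-↭ (trans π (prep x ρ)))
        (cong (λ r → parityℤ x ℙ.+ (parityℤ y ℙ.+ r)) (odd⇒parityΣ-constant (parity-pred 1+R≡n) all)))
      where
      solve : ∀ x y s → s ≡ x ℙ.+ (y ℙ.+ s ℙ.⁻¹) → x ℙ.+ y ≡ 1ℙ
      solve 0ℙ 1ℙ _  _ = refl
      solve 1ℙ 0ℙ _  _ = refl
      solve 0ℙ 0ℙ 0ℙ ()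
      solve 0ℙ 0ℙ 1ℙ ()
      solve 1ℙ 1ℙ 0ℙ ()
      solve 1ℙ 1ℙ 1ℙ ()
    -- The odd one of `x` and `y` lies in the orbit of 1, the even one in the orbit of 2.
    ordered : ∃[ u ] ∃[ v ] S ↭ u ∷ v ∷ R × u ∼ 1ℤ × v ∼ + 2
    ordered with parityℤ x in ex | parityℤ y in ey | mixed
    ... | 1ℙ | 0ℙ | _ = x , y , trans π (prep x ρ) , (ex , ≡-trans χx (sym χ1)) , (ey , ≡-trans χy (sym χ2))
    ... | 0ℙ | 1ℙ | _ = y , x , trans π (trans (prep x ρ) (swap x y refl)) , (ey , ≡-trans χy (sym χ1)) , (ex , ≡-trans χx (sym χ2))
    zeroes = support≡0⁻ R sR
    -- The common parity of `R` decides the form: even terms become 0 and give (⋆), odd terms become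
    -- `p` and give (∗∗) with `c = 2`.
    normalForm : ∀ q → All (λ z → parityℤ z ≡ q) R → NormalForm S
    normalForm 0ℙ all with ordered
    ... | u , v , τ , u∼1 , v∼2 = canonical , inj₁ canonical-form ,
      ∼.↭-trans (↭⇒↭∼ τ) (∼.prep u∼1 (∼.prep v∼2 (subst (λ m → R ↭∼ replicate m 0ℤ) (cong (_∸ 1) 1+R≡n)
        (constant⇒replicate (All.zipWith (λ (e , f) → e , ≡-trans f (sym χ0)) (all , zeroes))))))
    normalForm 1ℙ all with ordered
    ... | u , v , τ , u∼1 , v∼2 = _ , inj₂ (inj₂ (+ 2 , ∣-refl , refl)) ,
      ∼.↭-trans (↭⇒↭∼ (trans τ (swap u v refl))) (∼.prep v∼2 (∼.prep u∼1 (subst (λ m → R ↭∼ replicate m (+ p)) (cong (_∸ 1) 1+R≡n)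
        (constant⇒replicate (All.zipWith (λ (e , f) → ≡-trans e (sym parity-p) , ≡-trans f (sym χp)) (all , zeroes))))))

  opaque
    extremal⇒normalForm : ∀ {S} → Extremal S → NormalForm S
    extremal⇒normalForm {S} ex@(len , ¬zs) with support S ℕ.≟ 1 | support S ℕ.≟ 2
    ... | yes s≡1 | _       = support≡1⇒normalForm ex s≡1
    ... | no _    | yes s≡2 = support≡2⇒normalForm ex s≡2
    ... | no s≢1  | no s≢2  = contradiction (support≢1,2⇒hasZeroSum S len s≢1 s≢2) ¬zs

  extremal⇔normalForm : ∀ S → IsGaoExtremal n (U n) S ⇔
    (∃[ T ] length T ≡ n + 1 × Form T × Equivalent n (U n) S T)
  extremal⇔normalForm S = mk⇔ to from
    where
    n+1≡1+n = ℕ.+-comm n 1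
    to : IsGaoExtremal n (U n) S → ∃[ T ] length T ≡ n + 1 × Form T × Equivalent n (U n) S T
    to (k , isGao , len , ¬w) = T , ≡-trans (sym (equivalent-length {S} {T} eq)) (≡-trans len′ (sym n+1≡1+n)) , form , eq
      where
      len′ : length S ≡ suc n
      len′ = ≡-trans len (cong (_∸ 1) (gaoConstant-unique isGao))
      nf : NormalForm S
      nf = extremal⇒normalForm (len′ , ¬w ∘ zeroSum⇒weighted {S})
      T = proj₁ nf
      form = proj₁ (proj₂ nf)
      eq : Equivalent n (U n) S T
      eq = ↭∼⇒equivalent {S} {T} (proj₂ (proj₂ nf))
    from : ∃[ T ] length T ≡ n + 1 × Form T × Equivalent n (U n) S T → IsGaoExtremal n (U n) S
    from (T , lenT , form , eq) = suc (suc n) , isGaoConstant , len ,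
      blocked⇒¬hasZeroSum len (blocked-equivalent {S} {T} eq (form⇒blocked form)) ∘ weighted⇒zeroSum {S}
      where
      len : length S ≡ suc n
      len = ≡-trans (equivalent-length {S} {T} eq) (≡-trans lenT n+1≡1+n)

theorem3 : ∀ (n p : ℕ) → Prime p → Odd p → n ≡ 2 * p → (S : Sequence) →
    IsGaoExtremal n (U n) S ⇔
    (∃[ T ] length T ≡ n + 1 × (Form⋆ n p T ⊎ Form∗ n p T ⊎ Form∗∗ n p T) × Equivalent n (U n) S T)
theorem3 n p p-prime p-odd n≡2p = extremal⇔normalForm p-prime p-odd n≡2p
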